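{- Let $G$ be a bridgeless graph with $n$ vertices and $p$ blocks. Then the oriented diameter of $G$ satisfies \[\overrightarrow{\mathrm{diam}}(G) \leq n - \left\lfloor \frac{p}{2} \right\rfloor.\]
   Context: All graphs are finite and simple. A graph is bridgeless if it is connected and has no bridge (an edge whose removal disconnects the graph). A block of $G$ is a maximal connected subgraph of $G$ that has no cut vertex. An orientation of $G$ assigns a direction to each edge; it is strong if the resulting digraph is strongly connected. The diameter of a strong digraph is the maximum over ordered pairs $(u,v)$ of the directed distance from $u$ to $v$. The oriented diameter $\overrightarrow{\mathrm{diam}}(G)$ is the minimum diameter over all strong orientations of $G$ (which exist for bridgeless graphs by Robbins' theorem). -}

module Defs where

open import Data.Nat using (ℕ; zero; suc; _≤_)
open import Data.Fin using (Fin)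
open import Data.Fin.Subset using (Subset; _∈_; _⊆_)
open import Data.Bool using (Bool; true; false)
open import Data.Product using (Σ; ∃; ∃-syntax; _×_; _,_)
open import Data.Sum using (_⊎_)
open import Data.Unit using (⊤)
open import Relation.Nullary using (¬_)
open import Relation.Binary.PropositionalEquality using (_≡_; _≢_)

record Graph (n : ℕ) : Set where
  field
    adj    : Fin n → Fin n → Bool
    sym    : ∀ u v → adj u v ≡ adj v u
    irrefl : ∀ u → adj u u ≡ false
open Graph public

module _ {n : ℕ} where

  E : Graph n → Fin n → Fin n → Set
  E G u v = adj G u v ≡ true

  data Walk (R : Fin n → Fin n → Set) : Fin n → Fin n → ℕ → Set where
    here : ∀ {u} → Walk R u u 0
    step : ∀ {u v w k} → R u v → Walk R v w k → Walk R u w (suc k)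

  Restrict : (Fin n → Set) → (Fin n → Fin n → Set) → Fin n → Fin n → Set
  Restrict P R x y = P x × P y × R x y

  -- the subgraph (vertices P, edges R among them) is connected
  -- (nonemptiness is required separately where needed)
  ConnectedOn : (Fin n → Fin n → Set) → (Fin n → Set) → Set
  ConnectedOn R P = ∀ u v → P u → P v → ∃[ k ] Walk (Restrict P R) u v k

  Connected : Graph n → Set
  Connected G = (Σ (Fin n) (λ _ → ⊤)) × ConnectedOn (E G) (λ _ → ⊤)

  EdgeMinus : Graph n → Fin n → Fin n → Fin n → Fin n → Set
  EdgeMinus G u v x y = E G x y × ¬ ((x ≡ u × y ≡ v) ⊎ (x ≡ v × y ≡ u))

  IsBridge : Graph n → Fin n → Fin n → Set
  IsBridge G u v = E G u v × ¬ ConnectedOn (EdgeMinus G u v) (λ _ → ⊤)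

  Bridgeless : Graph n → Set
  Bridgeless G = Connected G × (∀ u v → ¬ IsBridge G u v)

  ConnNoCut : Graph n → Subset n → Set
  ConnNoCut G S =
    (∃[ x ] x ∈ S) × ConnectedOn (E G) (_∈ S)
    × (∀ w → w ∈ S → ConnectedOn (E G) (λ x → x ∈ S × x ≢ w))

  -- A block, represented by its vertex set (maximal such subgraphs are induced).
  IsBlock : Graph n → Subset n → Set
  IsBlock G S = ConnNoCut G S × (∀ T → S ⊆ T → ConnNoCut G T → T ⊆ S)

  BlockEnumeration : Graph n → (p : ℕ) → (Fin p → Subset n) → Set
  BlockEnumeration G p b =
    (∀ i j → b i ≡ b j → i ≡ j)
    × (∀ i → IsBlock G (b i))
    × (∀ S → IsBlock G S → ∃[ i ] b i ≡ S)

  IsOrientation : Graph n → (Fin n → Fin n → Bool) → Set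
  IsOrientation G D =
    (∀ u v → D u v ≡ true → E G u v)
    × (∀ u v → E G u v → (D u v ≡ true) ⊎ (D v u ≡ true))
    × (∀ u v → D u v ≡ true → D v u ≡ false)

  Arc : (Fin n → Fin n → Bool) → Fin n → Fin n → Set
  Arc D u v = D u v ≡ true

  DistAtMost : (Fin n → Fin n → Bool) → Fin n → Fin n → ℕ → Set
  DistAtMost D u v d = ∃[ k ] (k ≤ d × Walk (Arc D) u v k)

  Strong : (Fin n → Fin n → Bool) → Set
  Strong D = ∀ u v → ∃[ k ] Walk (Arc D) u v k

  DiamAtMost : (Fin n → Fin n → Bool) → ℕ → Set
  DiamAtMost D d = ∀ u v → DistAtMost D u v d

  OrientedDiamAtMost : Graph n → ℕ → Set
  OrientedDiamAtMost G d =
    ∃[ D ] (IsOrientation G D × Strong D × DiamAtMost D d)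

{-# OPTIONS --safe #-}
module Submission where

-- The vertex set is a tree of two-connected pieces glued at single vertices.  For q pieces on N
-- vertices, induction on q gives, for any prescribed x and y, a strong orientation of diameter at
-- most N − ⌊q/2⌋ in which moreover d(x,y) and d(y,x) are at most N − ⌊q/2⌋ − 1.  Remove two leaf
-- pieces A and B, attached at cA and cB, and apply the induction hypothesis to (cA,cB).  A walk
-- that does not cross between A and B leaves at least two vertices of a leaf piece unvisited; a
-- crossing one gains one from d(cA,cB).  If x ∈ A and y ∈ B, one more is gained in each direction
-- by orienting A so that some walk from x to cA misses a vertex of A, and B likewise from y to cB.
-- A block has no cut vertex, so by maximality it equals some piece, whence p ≤ q.

open import Defs
open import Data.Nat using (ℕ; zero; suc; _+_; _∸_; _≤_; _<_; z≤n; s≤s; ⌊_/2⌋)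
open import Data.Nat.DivMod using (_/_; m/n≡1+[m∸n]/n)
open import Data.Nat.Properties hiding (_≟_)
open import Data.Nat.Tactic.RingSolver using (solve-∀)
open import Data.Bool using (true; false)
open import Data.Empty using (⊥)
import Data.Bool.Properties as Bool
open import Data.Fin using (Fin; zero; suc)
open import Data.Fin.Properties using (_≟_; any?; injective⇒≤)
open import Data.Fin.Subset using (Subset; _∈_; _∉_; _⊆_; _⊂_; _∪_; _∩_; _-_; ∣_∣; ⁅_⁆; ⊤; inside; outside)
open import Data.Fin.Subset.Properties using (_∈?_; _⊆?_; ∈⊤; ∣⊤∣≡n; ∣⁅x⁆∣≡1; x∈⁅x⁆; x∈⁅y⁆⇒x≡y; ⊆-antisym; p⊆q⇒∣p∣≤∣q∣; p⊂q⇒∣p∣<∣q∣; p⊆p∪q; q⊆p∪q; x∈p∪q⁻; x∈p∪q⁺; x∈p∩q⁻; ∪-assoc; ∪-comm; p─q⊆p; x∈p∧x≢y⇒x∈p-y; x∈p⇒∣p-x∣<∣p∣)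
open import Data.List using (List; []; _∷_; allFin; cartesianProduct)
open import Data.List.Membership.Propositional.Properties using (∈-cartesianProduct⁺; ∈-allFin)
open import Data.List.Relation.Unary.All as All using (All; []; _∷_)
open import Data.Product using (∃₂; ∃-syntax; Σ-syntax; _×_; _,_; proj₁; proj₂; swap)
open import Data.Sum using (_⊎_; inj₁; inj₂; [_,_]′)
import Data.Sum as Sum
import Data.Unit as Unit
open import Data.Vec using ([]; _∷_; tabulate)
open import Data.Vec.Properties using ([]=⇒lookup; lookup⇒[]=; lookup∘tabulate)
open import Function using (_∘_; id)
open import Level using (0ℓ)
open import Relation.Binary using (Rel; Decidable)
open import Relation.Binary.Construct.Closure.ReflexiveTransitive as Star using (Star; ε; _◅_; _◅◅_)
open import Relation.Binary.PropositionalEquality using (_≡_; _≢_; refl; cong; subst; subst₂; trans)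
import Relation.Binary.PropositionalEquality as ≡
open import Relation.Nullary using (¬_; Dec; yes; no; does; contradiction; ¬?)
open import Relation.Nullary.Decidable using (map′; _×-dec_; _⊎-dec_; dec-true; dec-false; decidable-stable)
open import Relation.Unary using (Pred) renaming (Decidable to Decidable₁)

-- Finite sets

∣p∣+∣q∣≡∣p∪q∣+∣p∩q∣ : ∀ {n} (p q : Subset n) → ∣ p ∣ + ∣ q ∣ ≡ ∣ p ∪ q ∣ + ∣ p ∩ q ∣
∣p∣+∣q∣≡∣p∪q∣+∣p∩q∣ []            []            = refl
∣p∣+∣q∣≡∣p∪q∣+∣p∩q∣ (outside ∷ p) (outside ∷ q) = ∣p∣+∣q∣≡∣p∪q∣+∣p∩q∣ p q
∣p∣+∣q∣≡∣p∪q∣+∣p∩q∣ (inside  ∷ p) (outside ∷ q) = cong suc (∣p∣+∣q∣≡∣p∪q∣+∣p∩q∣ p q)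
∣p∣+∣q∣≡∣p∪q∣+∣p∩q∣ (outside ∷ p) (inside  ∷ q) =
  trans (+-suc ∣ p ∣ ∣ q ∣) (cong suc (∣p∣+∣q∣≡∣p∪q∣+∣p∩q∣ p q))
∣p∣+∣q∣≡∣p∪q∣+∣p∩q∣ (inside  ∷ p) (inside  ∷ q) =
  cong suc (trans (+-suc ∣ p ∣ ∣ q ∣)
    (trans (cong suc (∣p∣+∣q∣≡∣p∪q∣+∣p∩q∣ p q)) (≡.sym (+-suc ∣ p ∪ q ∣ ∣ p ∩ q ∣))))

module _ {n : ℕ} where

  private variable
    S T : Subset n
    u v w x y z c : Fin n

  filter : {P : Pred (Fin n) 0ℓ} → Decidable₁ P → Subset n
  filter P? = tabulate (does ∘ P?)

  ∈-filter⁺ : {P : Pred (Fin n) 0ℓ} (P? : Decidable₁ P) → P x → x ∈ filter P?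
  ∈-filter⁺ {x} P? px =
    lookup⇒[]= x _ (trans (lookup∘tabulate (does ∘ P?) x) (dec-true (P? x) px))

  ∈-filter⁻ : {P : Pred (Fin n) 0ℓ} (P? : Decidable₁ P) → x ∈ filter P? → P x
  ∈-filter⁻ {x} P? x∈ with P? x | trans (≡.sym (lookup∘tabulate (does ∘ P?) x)) ([]=⇒lookup x∈)
  ... | yes px | _ = px
  ... | no _   | ()

  ⊆-witness : ¬ S ⊆ T → ∃[ x ] (x ∈ S × x ∉ T)
  ⊆-witness {S} {T} S⊈T with any? (λ x → x ∈? S ×-dec ¬? (x ∈? T))
  ... | yes w = w
  ... | no ¬w = contradiction
    (λ {x} x∈S → decidable-stable (x ∈? T) (λ x∉T → ¬w (x , x∈S , x∉T))) S⊈T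

  MeetAt : Fin n → Subset n → Subset n → Set
  MeetAt c S T = ∀ {v} → v ∈ S → v ∈ T → v ≡ c

  ∣∪∣-meetAt : MeetAt c S T → ∣ S ∣ + ∣ T ∣ ≤ suc ∣ S ∪ T ∣
  ∣∪∣-meetAt {c} {S} {T} meet = begin
    ∣ S ∣ + ∣ T ∣         ≡⟨ ∣p∣+∣q∣≡∣p∪q∣+∣p∩q∣ S T ⟩
    ∣ S ∪ T ∣ + ∣ S ∩ T ∣ ≤⟨ +-monoʳ-≤ ∣ S ∪ T ∣ (p⊆q⇒∣p∣≤∣q∣ ∩⊆c) ⟩
    ∣ S ∪ T ∣ + ∣ ⁅ c ⁆ ∣ ≡⟨ cong (∣ S ∪ T ∣ +_) (∣⁅x⁆∣≡1 c) ⟩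
    ∣ S ∪ T ∣ + 1         ≡⟨ +-comm ∣ S ∪ T ∣ 1 ⟩
    suc ∣ S ∪ T ∣         ∎
    where
    open ≤-Reasoning
    ∩⊆c : S ∩ T ⊆ ⁅ c ⁆
    ∩⊆c v∈ with x∈p∩q⁻ S T v∈
    ... | v∈S , v∈T = subst (_∈ ⁅ c ⁆) (≡.sym (meet v∈S v∈T)) (x∈⁅x⁆ c)

  ⊆⇒∪≡ : S ⊆ T → S ∪ T ≡ T
  ⊆⇒∪≡ {S} {T} S⊆T =
    ⊆-antisym ([ S⊆T , id ]′ ∘ x∈p∪q⁻ S T) (q⊆p∪q S T)

  ⁅x⁆⊆ : x ∈ S → ⁅ x ⁆ ⊆ S
  ⁅x⁆⊆ {x} {S} x∈S y∈ = subst (_∈ S) (≡.sym (x∈⁅y⁆⇒x≡y x y∈)) x∈S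

  -- Reachability

  Walk⇒Star : ∀ {R u v k} → Walk {n} R u v k → Star R u v
  Walk⇒Star here       = ε
  Walk⇒Star (step r w) = r ◅ Walk⇒Star w

  Star⇒Walk : ∀ {R u v} → Star R u v → ∃[ k ] Walk {n} R u v k
  Star⇒Walk ε       = 0 , here
  Star⇒Walk (r ◅ w) = let k , w′ = Star⇒Walk w in suc k , step r w′

  Walk-map : ∀ {R Q u v k} → (∀ {a b} → R a b → Q a b) → Walk {n} R u v k → Walk Q u v k
  Walk-map f here       = here
  Walk-map f (step r w) = step (f r) (Walk-map f w)

  _++ʷ_ : ∀ {R u v w j k} → Walk {n} R u v j → Walk R v w k → Walk R u w (j + k)
  here     ++ʷ w′ = w′
  step r w ++ʷ w′ = step r (w ++ʷ w′)

  -- The last vertex `t` of a walk that lies in `K`, with the part of the walk after it; in the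
  -- first alternative the walk ends at `t`.
  Exit : Pred (Fin n) 0ℓ → Pred (Fin n) 0ℓ → Rel (Fin n) 0ℓ → Fin n → Set
  Exit K P R y = ∃[ t ] (K t × (t ≡ y ⊎
    ∃[ s ] (Restrict P R t s × ¬ K s × Star (Restrict (λ v → P v × ¬ K v) R) s y)))

  avoid-or-exit : ∀ {K P R} → Decidable₁ K → Star (Restrict P R) x y →
    (¬ K x × Star (Restrict (λ v → P v × ¬ K v) R) x y) ⊎ Exit K P R y
  avoid-or-exit {x} K? ε with K? x
  ... | yes k = inj₂ (x , k , inj₁ refl)
  ... | no ¬k = inj₁ (¬k , ε)
  avoid-or-exit {x} K? (r@(px , ps , q) ◅ w) with avoid-or-exit K? w | K? x
  ... | inj₂ e        | _     = inj₂ e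
  ... | inj₁ (¬s , w′) | yes k = inj₂ (x , k , inj₂ (_ , r , ¬s , w′))
  ... | inj₁ (¬s , w′) | no ¬k = inj₁ (¬k , ((px , ¬k) , (ps , ¬s) , q) ◅ w′)

  last-exit : ∀ {K P R} → Decidable₁ K → K x → Star (Restrict P R) x y → Exit K P R y
  last-exit K? k w with avoid-or-exit K? w
  ... | inj₁ (¬k , _) = contradiction k ¬k
  ... | inj₂ e        = e

  On : Subset n → Rel (Fin n) 0ℓ → Rel (Fin n) 0ℓ
  On S = Restrict (_∈ S)

  module _ {R : Rel (Fin n) 0ℓ} where

    FirstStep : Subset n → Fin n → Fin n → Set
    FirstStep S u v = ∃[ s ] (On S R u s × s ∈ S - u × Star (On (S - u) R) s v)

    -- Cutting the walk at its last visit to `u` discards all earlier returns. Since `u` can then be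
    -- deleted from `S`, the size of `S` serves as a measure for recursion.
    first-step : u ≢ v → Star (On S R) u v → FirstStep S u v
    first-step {u} u≢v w with last-exit (_≟ u) refl w
    ... | _ , refl , inj₁ refl = contradiction refl u≢v
    ... | _ , refl , inj₂ (s , r@(_ , s∈S , _) , s≢u , w′) =
      s , r , x∈p∧x≢y⇒x∈p-y s∈S s≢u ,
      Star.map (λ ((a∈S , a≢u) , (b∈S , b≢u) , q) →
        x∈p∧x≢y⇒x∈p-y a∈S a≢u , x∈p∧x≢y⇒x∈p-y b∈S b≢u , q) w′

    -- Each step deletes the vertex just left, so no vertex is repeated; `m` only bounds the
    -- recursion.
    shorten : ∀ m → ∣ S ∣ ≤ m → u ∈ S → Star (On S R) u v → ∃[ k ] (k < ∣ S ∣ × Walk R u v k)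
    shorten {S} {u} {v} m S≤m u∈S w with u ≟ v
    ... | yes refl = 0 , ≤-<-trans z≤n (x∈p⇒∣p-x∣<∣p∣ u∈S) , here
    shorten {S} {u} zero S≤m u∈S w | no u≢v =
      contradiction (≤-<-trans z≤n (x∈p⇒∣p-x∣<∣p∣ u∈S)) (≤⇒≯ S≤m)
    shorten {S} {u} (suc m) S≤m u∈S w | no u≢v with first-step u≢v w
    ... | s , (_ , _ , r) , s∈ , w′
      with shorten m (≤-pred (≤-trans (x∈p⇒∣p-x∣<∣p∣ u∈S) S≤m)) s∈ w′
    ... | k , k< , w″ = suc k , ≤-<-trans k< (x∈p⇒∣p-x∣<∣p∣ u∈S) , step r w″

    short : u ∈ S → Star (On S R) u v → ∃[ k ] (k < ∣ S ∣ × Walk R u v k)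
    short = shorten _ ≤-refl

    module _ (R? : Decidable R) where

      -- The recursion of `shorten` as a search: look for an out-neighbour that reaches `v` within
      -- `S - u`.
      reachOn? : ∀ m S → ∣ S ∣ ≤ m → ∀ u v → Dec (Star (On S R) u v)
      reachOn? m S S≤m u v with u ≟ v | u ∈? S
      ... | yes refl | _      = yes ε
      ... | no u≢v   | no u∉S = no λ { ε → u≢v refl ; ((u∈S , _) ◅ _) → u∉S u∈S }
      reachOn? zero S S≤m u v | no _ | yes u∈S =
        contradiction (≤-<-trans z≤n (x∈p⇒∣p-x∣<∣p∣ u∈S)) (≤⇒≯ S≤m)
      reachOn? (suc m) S S≤m u v | no u≢v | yes u∈S =
        map′ (λ (s , r , _ , w) → r ◅ Star.map (λ (a , b , q) → p─q⊆p S _ a , p─q⊆p S _ b , q) w)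
             (first-step u≢v)
             (any? λ s → (yes u∈S ×-dec s ∈? S ×-dec R? u s) ×-dec s ∈? (S - u) ×-dec
               reachOn? m (S - u) (≤-pred (≤-trans (x∈p⇒∣p-x∣<∣p∣ u∈S) S≤m)) s v)

      reach? : Decidable (Star R)
      reach? u v = map′ (Star.map (proj₂ ∘ proj₂)) (Star.map (λ r → ∈⊤ , ∈⊤ , r))
        (reachOn? _ ⊤ ≤-refl u v)

  -- Strong orientations

  Minus : Rel (Fin n) 0ℓ → Fin n → Fin n → Rel (Fin n) 0ℓ
  Minus R u v a b = R a b × ¬ (a ≡ u × b ≡ v)

  Minus? : ∀ {R} → Decidable R → ∀ u v → Decidable (Minus R u v)
  Minus? R? u v a b = R? a b ×-dec ¬? ((a ≟ u) ×-dec (b ≟ v))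

  OnWalk : ∀ {R : Rel (Fin n) 0ℓ} {a b} → Star R a b → Pred (Fin n) 0ℓ
  OnWalk (ε {a})       t = t ≡ a
  OnWalk (_◅_ {a} _ w) t = t ≡ a ⊎ OnWalk w t

  OnArc : ∀ {R : Rel (Fin n) 0ℓ} {a b} → Star R a b → Rel (Fin n) 0ℓ
  OnArc ε                 s t = ⊥
  OnArc (_◅_ {a} {b} _ w) s t = (s ≡ a × t ≡ b) ⊎ OnArc w s t

  module _ {R : Rel (Fin n) 0ℓ} where

    onWalk? : (w : Star R x y) → Decidable₁ (OnWalk w)
    onWalk? (ε {a})       t = t ≟ a
    onWalk? (_◅_ {a} _ w) t = (t ≟ a) ⊎-dec onWalk? w t

    onArc? : (w : Star R x y) → Decidable (OnArc w)
    onArc? ε                 s t = no λ ()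
    onArc? (_◅_ {a} {b} _ w) s t = ((s ≟ a) ×-dec (t ≟ b)) ⊎-dec onArc? w s t

    onWalk-start : (w : Star R x y) → OnWalk w x
    onWalk-start ε       = refl
    onWalk-start (_ ◅ _) = inj₁ refl

    onWalk-end : (w : Star R x y) → OnWalk w y
    onWalk-end ε       = refl
    onWalk-end (_ ◅ w) = inj₂ (onWalk-end w)

    onArc⇒onWalk : (w : Star R x y) → OnArc w u v → OnWalk w u × OnWalk w v
    onArc⇒onWalk (_ ◅ w) (inj₁ (refl , refl)) = inj₁ refl , inj₂ (onWalk-start w)
    onArc⇒onWalk (_ ◅ w) (inj₂ e) = let a , b = onArc⇒onWalk w e in inj₂ a , inj₂ b

    onArc⇒R : (w : Star R x y) → OnArc w u v → R u v
    onArc⇒R (r ◅ _) (inj₁ (refl , refl)) = r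
    onArc⇒R (_ ◅ w) (inj₂ e)             = onArc⇒R w e

    -- Together with `back-to-start`, this gives the walks that remain when the arcs of a closed
    -- walk are turned around.
    back-from-end : (w : Star R x y) → OnWalk w v → Star (λ s t → OnArc w t s) y v
    back-from-end ε       refl        = ε
    back-from-end (_ ◅ w) (inj₁ refl) =
      Star.map inj₂ (back-from-end w (onWalk-start w)) ◅◅ inj₁ (refl , refl) ◅ ε
    back-from-end (_ ◅ w) (inj₂ v∈w)  = Star.map inj₂ (back-from-end w v∈w)

    back-to-start : (w : Star R x y) → OnWalk w v → Star (λ s t → OnArc w t s) v x
    back-to-start ε       refl        = ε
    back-to-start (_ ◅ w) (inj₁ refl) = ε
    back-to-start (_ ◅ w) (inj₂ v∈w)  =
      Star.map inj₂ (back-to-start w v∈w) ◅◅ inj₁ (refl , refl) ◅ ε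

module _ {n : ℕ} (G : Graph n) where

  private variable
    S T B : Subset n
    u v w x y z c r s : Fin n
    q : ℕ

  E? : Decidable (E G)
  E? u v = adj G u v Bool.≟ true

  E-sym : E G u v → E G v u
  E-sym {u} {v} e = trans (sym G v u) e

  E⇒≢ : E G u v → u ≢ v
  E⇒≢ {u} e refl with trans (≡.sym e) (irrefl G u)
  ... | ()

  -- Robbins' theorem on vertex subsets

  record BridgelessOn (S : Subset n) : Set where
    field
      connected : u ∈ S → v ∈ S → Star (On S (E G)) u v
      -- Absence of bridges in positive form: unlike a negated statement, a walk around an edge can
      -- be projected to a part of `S`.
      detour    : u ∈ S → v ∈ S → E G u v → Star (On S (EdgeMinus G u v)) u v

  -- A mixed graph on S: an edge carrying both arcs is not yet oriented.
  record StrongMixed (S : Subset n) : Set₁ where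
    field
      R      : Rel (Fin n) 0ℓ
      R?     : Decidable R
      within : R u v → u ∈ S × v ∈ S × E G u v
      covers : u ∈ S → v ∈ S → E G u v → R u v ⊎ R v u
      strong : u ∈ S → v ∈ S → Star R u v

  record StrongOrientation (S : Subset n) : Set₁ where
    field
      mixed : StrongMixed S
    open StrongMixed mixed public
    field
      asym  : R u v → ¬ R v u

  open StrongMixed using () renaming (R to arcs)

  -- The arc from `v` to `u` still covers the edge, and the given walk replaces every use of the
  -- dropped arc. The equation exposes the arcs of the new mixed graph to the caller.
  dropArc : (M : StrongMixed S) → arcs M v u → Star (Minus (arcs M) u v) u v →
            Σ[ M′ ∈ StrongMixed S ] arcs M′ ≡ Minus (arcs M) u v
  dropArc {v = v} {u = u} M vu u⇝v = record
    { R      = Minus R u v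
    ; R?     = Minus? R? u v
    ; within = within ∘ proj₁
    ; covers = λ a∈S b∈S e → [ keep , Sum.swap ∘ keep ]′ (covers a∈S b∈S e)
    ; strong = λ a∈S b∈S → Star.kleisliStar id replace (strong a∈S b∈S)
    } , refl
    where
    open StrongMixed M
    keep : ∀ {a b} → R a b → Minus R u v a b ⊎ Minus R u v b a
    keep {a} {b} ab with (a ≟ u) ×-dec (b ≟ v)
    ... | no a≢           = inj₁ (ab , a≢)
    ... | yes (refl , refl) = inj₂ (vu , λ (v≡u , _) → E⇒≢ (proj₂ (proj₂ (within vu))) v≡u)
    replace : ∀ {a b} → R a b → Star (Minus R u v) a b
    replace {a} {b} ab with (a ≟ u) ×-dec (b ≟ v)
    ... | no a≢           = (ab , a≢) ◅ ε
    ... | yes (refl , refl) = u⇝v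

  -- If neither arc can be dropped, the vertices reachable from u and those reachable
  -- from v (without the edge uv) form a partition showing that uv is a bridge.
  droppable : BridgelessOn S → (M : StrongMixed S) → arcs M u v → arcs M v u →
              ¬ Star (Minus (arcs M) u v) u v → ¬ ¬ Star (Minus (arcs M) v u) v u
  droppable {S = S} {u = u} {v = v} bl M uv vu ¬u⇝v ¬v⇝u =
    u̸⇝v (along (detour u∈S v∈S e) ε)
    where
    open BridgelessOn bl
    open StrongMixed M
    u∈S = proj₁ (within uv)
    v∈S = proj₁ (proj₂ (within uv))
    e   = proj₂ (proj₂ (within uv))
    R₀ : Rel (Fin n) 0ℓ
    R₀ a b = R a b × ¬ (a ≡ u × b ≡ v) × ¬ (a ≡ v × b ≡ u)
    u̸⇝v : ¬ Star R₀ u v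
    u̸⇝v = ¬u⇝v ∘ Star.map λ (ab , p , _) → ab , p
    v̸⇝u : ¬ Star R₀ v u
    v̸⇝u = ¬v⇝u ∘ Star.map λ (ab , _ , p) → ab , p
    -- Each use of the edge lands on `u` or `v`, and the walk is restarted there.
    from : ∀ {a b} → Star R a b → Star R₀ u a ⊎ Star R₀ v a → Star R₀ u b ⊎ Star R₀ v b
    from ε h = h
    from (_◅_ {a} {b} ab w) h with (a ≟ u) ×-dec (b ≟ v) | (a ≟ v) ×-dec (b ≟ u)
    ... | yes (_ , refl) | _              = from w (inj₂ ε)
    ... | no _           | yes (_ , refl) = from w (inj₁ ε)
    ... | no p           | no p′          =
      from w (Sum.map (_◅◅ (ab , p , p′) ◅ ε) (_◅◅ (ab , p , p′) ◅ ε) h)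
    -- Dually, the walk is stopped at its first use of the edge, where it stands at `u` or `v`.
    to : ∀ {a} → Star R a u → Star R₀ a u ⊎ Star R₀ a v
    to ε = inj₁ ε
    to (_◅_ {a} {b} ab w) with (a ≟ u) ×-dec (b ≟ v) | (a ≟ v) ×-dec (b ≟ u)
    ... | yes (refl , _) | _              = inj₁ ε
    ... | no _           | yes (refl , _) = inj₂ ε
    ... | no p           | no p′          = Sum.map ((ab , p , p′) ◅_) ((ab , p , p′) ◅_) (to w)
    -- A vertex in both classes reaches `u` or `v` without the edge, which closes a forbidden walk
    -- between the two.
    disjoint : ∀ {a} → a ∈ S → Star R₀ u a → ¬ Star R₀ v a
    disjoint a∈S ua va with to (strong a∈S u∈S)
    ... | inj₁ au = v̸⇝u (va ◅◅ au)
    ... | inj₂ av = u̸⇝v (ua ◅◅ av)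
    -- The detour never leaves the class of `u`: an edge to a vertex `b` in the class of `v` only
    -- would have to be oriented from `b` to `a`, which puts `a` in both classes.
    along : ∀ {a b} → Star (On S (EdgeMinus G u v)) a b → Star R₀ u a → Star R₀ u b
    along ε ua = ua
    along (_◅_ {a} {b} (a∈S , b∈S , ab , p) w) ua = along w (next (covers a∈S b∈S ab))
      where
      next : R a b ⊎ R b a → Star R₀ u b
      next (inj₁ ab) = ua ◅◅ (ab , p ∘ inj₁ , p ∘ inj₂) ◅ ε
      next (inj₂ ba) with from (strong u∈S b∈S) (inj₁ ε)
      ... | inj₁ ub = ub
      ... | inj₂ vb = contradiction
        (vb ◅◅ (ba , (λ (x , y) → p (inj₂ (y , x))) , (λ (x , y) → p (inj₁ (y , x)))) ◅ ε)
        (disjoint a∈S ua)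

  OneWay : StrongMixed S → Fin n × Fin n → Set
  OneWay M (u , v) = ¬ (arcs M u v × arcs M v u)

  -- By `droppable`, one of two opposite arcs can go. That arcs only disappear is recorded because
  -- it keeps earlier edges oriented.
  orientEdge : BridgelessOn S → (M : StrongMixed S) → ∀ u v →
    Σ[ M′ ∈ StrongMixed S ] ((∀ {a b} → arcs M′ a b → arcs M a b) × OneWay M′ (u , v))
  orientEdge bl M u v with R? u v | R? v u | reach? (Minus? R? u v) u v | reach? (Minus? R? v u) v u
    where open StrongMixed M
  ... | no ¬uv | _      | _     | _     = M , id , ¬uv ∘ proj₁
  ... | yes _  | no ¬vu | _     | _     = M , id , ¬vu ∘ proj₂
  ... | yes uv | yes vu | no p  | no p′ = contradiction p′ (droppable bl M uv vu p)
  ... | yes uv | yes vu | yes w | _     with dropArc M vu w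
  ...   | M′ , refl = M′ , proj₁ , λ (a , _) → proj₂ a (refl , refl)
  orientEdge bl M u v | yes uv | yes vu | no _ | yes w with dropArc M uv w
  ...   | M′ , refl = M′ , proj₁ , λ (_ , a) → proj₂ a (refl , refl)

  orientEdges : BridgelessOn S → StrongMixed S → (l : List (Fin n × Fin n)) →
    Σ[ M ∈ StrongMixed S ] All (OneWay M) l
  orientEdges bl M []            = M , []
  orientEdges bl M ((u , v) ∷ l) =
    let M₁ , oriented₁           = orientEdges bl M l
        M₂ , M₂⊆M₁ , oriented₂ = orientEdge bl M₁ u v
    in  M₂ , oriented₂ ∷ All.map (λ ¬both (a , b) → ¬both (M₂⊆M₁ a , M₂⊆M₁ b)) oriented₁

  -- Every edge starts with both arcs; running through all vertex pairs leaves one arc each while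
  -- strong connectivity is kept.
  robbins : BridgelessOn S → StrongOrientation S
  robbins {S = S} bl =
    let M , oriented = orientEdges bl undirected (cartesianProduct (allFin n) (allFin n))
    in  record { mixed = M ; asym = λ {u} {v} uv vu →
          All.lookup oriented (∈-cartesianProduct⁺ (∈-allFin u) (∈-allFin v)) (uv , vu) }
    where
    open BridgelessOn bl
    undirected : StrongMixed S
    undirected = record
      { R      = On S (E G)
      ; R?     = λ a b → a ∈? S ×-dec b ∈? S ×-dec E? a b
      ; within = id
      ; covers = λ a∈S b∈S e → inj₁ (a∈S , b∈S , e)
      ; strong = connected
      }

  -- Strong connectivity survives because, by `around`, the reversed arcs alone still lead from the
  -- tail to the head of each arc of `C`, as they do for a closed walk.
  reverseArcs : (O : StrongOrientation S) → let open StrongOrientation O in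
    {C : Rel (Fin n) 0ℓ} → Decidable C → (∀ {a b} → C a b → R a b) →
    (∀ {a b} → C a b → Star (λ s t → C t s) a b) →
    Σ[ O′ ∈ StrongOrientation S ]
      StrongOrientation.R O′ ≡ (λ a b → C b a ⊎ (R a b × ¬ C a b))
  reverseArcs O {C} C? C⊆R around = record
    { mixed = record
      { R      = R′
      ; R?     = λ a b → C? b a ⊎-dec (R? a b ×-dec ¬? (C? a b))
      ; within = within′
      ; covers = λ a∈S b∈S e → [ keep , Sum.swap ∘ keep ]′ (covers a∈S b∈S e)
      ; strong = λ a∈S b∈S → Star.kleisliStar id replace (strong a∈S b∈S)
      }
    ; asym = asym′
    } , refl
    where
    open StrongOrientation O
    R′ : Rel (Fin n) 0ℓ
    R′ a b = C b a ⊎ (R a b × ¬ C a b)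
    within′ : ∀ {a b} → R′ a b → _
    within′ (inj₁ ba)       = let b∈ , a∈ , e = within (C⊆R ba) in a∈ , b∈ , E-sym e
    within′ (inj₂ (ab , _)) = within ab
    keep : ∀ {a b} → R a b → R′ a b ⊎ R′ b a
    keep {a} {b} ab with C? a b
    ... | yes c = inj₂ (inj₁ c)
    ... | no ¬c = inj₁ (inj₂ (ab , ¬c))
    replace : ∀ {a b} → R a b → Star R′ a b
    replace {a} {b} ab with C? a b
    ... | yes c = Star.map inj₁ (around c)
    ... | no ¬c = inj₂ (ab , ¬c) ◅ ε
    asym′ : ∀ {a b} → R′ a b → ¬ R′ b a
    asym′ (inj₁ ba)        (inj₁ ab)        = asym (C⊆R ab) (C⊆R ba)
    asym′ (inj₁ ba)        (inj₂ (_ , ¬ba)) = ¬ba ba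
    asym′ (inj₂ (_ , ¬ab)) (inj₁ ab)        = ¬ab ab
    asym′ (inj₂ (ab , _))  (inj₂ (ba , _))  = asym ab ba

  -- Orientations with a walk that misses a vertex

  Avoiding : Subset n → Fin n → Rel (Fin n) 0ℓ → Rel (Fin n) 0ℓ
  Avoiding S z = Restrict (λ v → v ∈ S × v ≢ z)

  -- Take a closed walk x → v₂ → v₃ ⇝ x whose last part avoids v₂, and a walk to y leaving it
  -- for the last time at t.  If t = v₂ then x → v₂ ⇝ y misses v₃; otherwise reversing the
  -- closed walk makes t reachable from x without v₂.
  avoidVertex : StrongOrientation S → x ∈ S → y ∈ S → x ≢ y →
    Σ[ O ∈ StrongOrientation S ] ∃[ z ] (z ∈ S × Star (Avoiding S z (StrongOrientation.R O)) x y)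
  avoidVertex {S = S} {x = x} {y = y} O x∈S y∈S x≢y with StrongOrientation.strong O x∈S y∈S
  ... | ε = contradiction refl x≢y
  ... | _◅_ {j = v₂} x→v₂ _
    with last-exit (_≟ v₂) refl (Star.map (λ r → let a , b , _ = within r in a , b , r) (strong v₂∈S x∈S))
    where
    open StrongOrientation O
    v₂∈S = proj₁ (proj₂ (within x→v₂))
  ... | _ , refl , inj₁ refl = contradiction refl (E⇒≢ (proj₂ (proj₂ (StrongOrientation.within O x→v₂))))
  ... | _ , refl , inj₂ (v₃ , (v₂∈S , v₃∈S , v₂→v₃) , v₃≢v₂ , Q) = go (last-exit K? (inj₂ (onWalk-end Q)) x⇝y)
    where
    open StrongOrientation O
    -- An orientation has no closed walk of length two, so `v₃` differs from `x` and can be missed.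
    x≢v₃ : x ≢ v₃
    x≢v₃ refl = asym x→v₂ v₂→v₃
    K : Pred (Fin n) 0ℓ
    K t = t ≡ v₂ ⊎ OnWalk Q t
    K? : Decidable₁ K
    K? t = (t ≟ v₂) ⊎-dec onWalk? Q t
    x⇝y : Star (On S R) x y
    x⇝y = Star.map (λ r → let a , b , _ = within r in a , b , r) (strong x∈S y∈S)
    C : Rel (Fin n) 0ℓ
    C a b = (a ≡ x × b ≡ v₂) ⊎ (a ≡ v₂ × b ≡ v₃) ⊎ OnArc Q a b
    C? : Decidable C
    C? a b = ((a ≟ x) ×-dec (b ≟ v₂)) ⊎-dec (((a ≟ v₂) ×-dec (b ≟ v₃)) ⊎-dec onArc? Q a b)
    C⊆R : ∀ {a b} → C a b → R a b
    C⊆R (inj₁ (refl , refl))        = x→v₂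
    C⊆R (inj₂ (inj₁ (refl , refl))) = v₂→v₃
    C⊆R (inj₂ (inj₂ e))             = proj₂ (proj₂ (onArc⇒R Q e))
    head∈K : ∀ {a b} → C a b → K b
    head∈K (inj₁ (_ , refl))        = inj₁ refl
    head∈K (inj₂ (inj₁ (_ , refl))) = inj₂ (onWalk-start Q)
    head∈K (inj₂ (inj₂ e))          = inj₂ (proj₂ (onArc⇒onWalk Q e))
    fromX : ∀ {t} → OnWalk Q t → Star (λ a b → C b a) x t
    fromX t∈Q = Star.map (inj₂ ∘ inj₂) (back-from-end Q t∈Q)
    toV₃ : ∀ {t} → OnWalk Q t → Star (λ a b → C b a) t v₃
    toV₃ t∈Q = Star.map (inj₂ ∘ inj₂) (back-to-start Q t∈Q)
    v₃⇝v₂ : Star (λ a b → C b a) v₃ v₂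
    v₃⇝v₂ = inj₂ (inj₁ (refl , refl)) ◅ ε
    v₂⇝x : Star (λ a b → C b a) v₂ x
    v₂⇝x = inj₁ (refl , refl) ◅ ε
    around : ∀ {a b} → C a b → Star (λ s t → C t s) a b
    around (inj₁ (refl , refl))        = toV₃ (onWalk-end Q) ◅◅ v₃⇝v₂
    around (inj₂ (inj₁ (refl , refl))) = v₂⇝x ◅◅ fromX (onWalk-start Q)
    around (inj₂ (inj₂ e))             =
      let a∈Q , b∈Q = onArc⇒onWalk Q e in toV₃ a∈Q ◅◅ v₃⇝v₂ ◅◅ v₂⇝x ◅◅ fromX b∈Q
    go : Exit K (_∈ S) R y →
      Σ[ O ∈ StrongOrientation S ] ∃[ z ] (z ∈ S × Star (Avoiding S z (StrongOrientation.R O)) x y)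
    -- After its last visit to `v₂` the walk stays off `K`, which contains `v₃`.
    go (_ , inj₁ refl , tail) = O , v₃ , v₃∈S , ((x∈S , x≢v₃) , v₂∉ , x→v₂) ◅ rest tail
      where
      v₂∉ : v₂ ∈ S × v₂ ≢ v₃
      v₂∉ = v₂∈S , v₃≢v₂ ∘ ≡.sym
      K∌⇒≢v₃ : ∀ {a} → ¬ K a → a ≢ v₃
      K∌⇒≢v₃ ¬k refl = ¬k (inj₂ (onWalk-start Q))
      rest : _ → Star (Avoiding S v₃ R) v₂ y
      rest (inj₁ refl) = ε
      rest (inj₂ (s , (_ , s∈S , r) , ¬ks , w)) =
        (v₂∉ , (s∈S , K∌⇒≢v₃ ¬ks) , r) ◅
        Star.map (λ ((a∈ , ¬ka) , (b∈ , ¬kb) , r) → (a∈ , K∌⇒≢v₃ ¬ka) , (b∈ , K∌⇒≢v₃ ¬kb) , r) w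
    go (t , inj₂ t∈Q , tail) with reverseArcs O C? C⊆R around
    ... | O′ , refl = O′ , v₂ , v₂∈S ,
      -- Reversed, `Q` leads from `x` to `t` and misses `v₂`.
      (Star.map (λ e → let a , b , _ = onArc⇒R Q e in b , a , inj₁ (inj₂ (inj₂ e))) (back-from-end Q t∈Q) ◅◅ rest tail)
      where
      rest : _ → Star (Avoiding S v₂ _) t y
      rest (inj₁ refl) = ε
      rest (inj₂ (s , (t∈S , s∈S , r) , ¬ks , w)) =
        -- The remaining arcs end outside `K` while those of `C` end in `K`, so they keep their
        -- direction.
        ((t∈S , t≢v₂) , (s∈S , ¬ks ∘ inj₁) , inj₂ (r , ¬ks ∘ head∈K)) ◅
        Star.map (λ ((a∈ , ¬ka) , (b∈ , ¬kb) , r) →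
          (a∈ , ¬ka ∘ inj₁) , (b∈ , ¬kb ∘ inj₁) , inj₂ (r , ¬kb ∘ head∈K)) w
        where
        t≢v₂ : t ≢ v₂
        t≢v₂ refl = v₂∉Q Q v₃≢v₂ t∈Q
          where
          v₂∉Q : ∀ {a b} (w : Star (Avoiding S v₂ R) a b) → a ≢ v₂ → ¬ OnWalk w v₂
          v₂∉Q ε a≢ refl = a≢ refl
          v₂∉Q (_ ◅ w) a≢ (inj₁ refl) = a≢ refl
          v₂∉Q ((_ , (_ , b≢) , _) ◅ w) a≢ (inj₂ o) = v₂∉Q w b≢ o

  -- Trees of two-connected pieces

  -- `distinct` excludes a single vertex and `bridgeless` a single edge; both satisfy `ConnNoCut`.
  record Piece (B : Subset n) : Set where
    field
      noCut      : ConnNoCut G B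
      bridgeless : BridgelessOn B
      distinct   : ∃₂ λ a b → a ∈ B × b ∈ B × a ≢ b

  -- Distance at most N − h, stated so as to avoid truncated subtraction.
  Near : Rel (Fin n) 0ℓ → ℕ → ℕ → Rel (Fin n) 0ℓ
  Near R h N u v = ∃[ k ] (k + h ≤ N × Walk R u v k)

  Near-trans : ∀ {R h i M N} → Near R h M u v → Near R i N v w → Near R (h + i) (M + N) u w
  Near-trans {h = h} {i} {M} {N} (k , k≤ , p) (l , l≤ , p′) = k + l , bound , p ++ʷ p′
    where
    open ≤-Reasoning
    bound : k + l + (h + i) ≤ M + N
    bound = begin
      k + l + (h + i)   ≡⟨ interchange k l h i ⟩
      (k + h) + (l + i) ≤⟨ +-mono-≤ k≤ l≤ ⟩
      M + N             ∎
      where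
      interchange : ∀ k l h i → k + l + (h + i) ≡ (k + h) + (l + i)
      interchange = solve-∀

  -- The hypothesis expresses M - h ≤ N - i without subtraction.
  Near-weaken : ∀ {R h i M N} → i + M ≤ N + h → Near R h M u v → Near R i N u v
  Near-weaken {h = h} {i} {M} {N} i+M≤N+h (k , k≤ , p) = k , +-cancelʳ-≤ h _ _ bound , p
    where
    open ≤-Reasoning
    bound : k + i + h ≤ N + h
    bound = begin
      k + i + h   ≡⟨ +-assoc k i h ⟩
      k + (i + h) ≡⟨ cong (k +_) (+-comm i h) ⟩
      k + (h + i) ≡⟨ +-assoc k h i ⟨
      k + h + i   ≤⟨ +-monoˡ-≤ i k≤ ⟩
      M + i       ≡⟨ +-comm M i ⟩
      i + M       ≤⟨ i+M≤N+h ⟩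
      N + h       ∎

  Near-map : ∀ {R R′ h N} → (∀ {a b} → R a b → R′ a b) → Near R h N u v → Near R′ h N u v
  Near-map f (k , k≤ , p) = k , k≤ , Walk-map f p

  Near-refl : ∀ {R h N} → h ≤ N → Near R h N u u
  Near-refl h≤N = 0 , h≤N , here

  Near-≢ : ∀ {R h N} → u ≢ v → Near R h N u v → suc h ≤ N
  Near-≢ u≢v (zero  , _  , here) = contradiction refl u≢v
  Near-≢ u≢v (suc k , k≤ , _)    = ≤-trans (s≤s (m≤n+m _ k)) k≤

  near-within : (O : StrongOrientation S) → u ∈ S → v ∈ S →
                Near (StrongOrientation.R O) 1 ∣ S ∣ u v
  near-within {S = S} O u∈S v∈S
    with short u∈S (Star.map (λ r → let a , b , _ = within r in a , b , r) (strong u∈S v∈S))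
    where open StrongOrientation O
  ... | k , k< , p = k , subst (_≤ ∣ S ∣) (+-comm 1 k) k< , p

  -- The walk missing `z` lives on one vertex fewer than `B` has, which saves one more arc than
  -- `near-within`.
  orientTowards-≢ : Piece B → x ∈ B → y ∈ B → x ≢ y →
    Σ[ O ∈ StrongOrientation B ] Near (StrongOrientation.R O) 2 ∣ B ∣ x y
  orientTowards-≢ {B = B} {x = x} P x∈B y∈B x≢y with avoidVertex (robbins (Piece.bridgeless P)) x∈B y∈B x≢y
  ... | O , z , z∈B , ε = contradiction refl x≢y
  ... | O , z , z∈B , w@(((_ , x≢z) , _) ◅ _)
    with short {S = B - z} (x∈p∧x≢y⇒x∈p-y x∈B x≢z)
      (Star.map (λ ((a∈ , a≢) , (b∈ , b≢) , r) → x∈p∧x≢y⇒x∈p-y a∈ a≢ , x∈p∧x≢y⇒x∈p-y b∈ b≢ , r) w)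
  ... | k , k< , p = O , k , subst (_≤ ∣ B ∣) (+-comm 2 k) (≤-<-trans k< (x∈p⇒∣p-x∣<∣p∣ z∈B)) , p

  -- Two distinct vertices are at distance at least 1 and, in a suitable orientation, at most the
  -- size of `B` minus 2.
  3≤∣piece∣ : Piece B → 3 ≤ ∣ B ∣
  3≤∣piece∣ P = let _ , _ , a∈B , b∈B , a≢b = Piece.distinct P in
    Near-≢ a≢b (proj₂ (orientTowards-≢ P a∈B b∈B a≢b))

  orientTowards : Piece B → x ∈ B → y ∈ B →
    Σ[ O ∈ StrongOrientation B ] Near (StrongOrientation.R O) 2 ∣ B ∣ x y
  orientTowards {x = x} {y = y} P x∈B y∈B with x ≟ y
  ... | no x≢y   = orientTowards-≢ P x∈B y∈B x≢y
  ... | yes refl = robbins (Piece.bridgeless P) , Near-refl (<⇒≤ (3≤∣piece∣ P))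

  -- An edge between the two sets lies inside one of them, so orienting both induced subgraphs
  -- covers the union.
  NoCross : Subset n → Subset n → Set
  NoCross S T = ∀ {u v} → u ∈ S → v ∈ T → E G u v → v ∈ S ⊎ u ∈ T

  NoCross-sym : NoCross S T → NoCross T S
  NoCross-sym nc u∈T v∈S e = Sum.swap (nc v∈S u∈T (E-sym e))

  -- The outermost `attach` adds a leaf piece, which an induction can strip off; the root remains at
  -- every stage.
  data Tree : Fin n → ℕ → Subset n → Set where
    root   : Tree r 0 ⁅ r ⁆
    attach : Tree r q S → Piece B → c ∈ S → c ∈ B → MeetAt c S B → NoCross S B →
             Tree r (suc q) (S ∪ B)

  root∈ : Tree r q S → r ∈ S
  root∈ {r = r} root          = x∈⁅x⁆ r
  root∈ (attach t _ _ _ _ _) = p⊆p∪q _ (root∈ t)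

  -- The pieces of the second tree are attached in their old order. Its root `c` is the only vertex
  -- shared with `S`, so whatever a later piece has in common with `S` already lies in the part of
  -- the second tree built before it.
  join : ∀ {q′} → Tree r q S → Tree c q′ T → c ∈ S → MeetAt c S T → NoCross S T →
         Tree r (q′ + q) (S ∪ T)
  join {r = r} {q = q} {S = S} {c = c} t root c∈S _ _ =
    subst (Tree r q) (≡.sym (trans (∪-comm S ⁅ c ⁆) (⊆⇒∪≡ (⁅x⁆⊆ c∈S)))) t
  join {r = r} {q = q} {S = S} {c = c} t (attach {q = q′} {S = T} {B = B} {c = d} t′ P d∈T d∈B meet nc) c∈S meet′ nc′ =
    subst (Tree r _) (∪-assoc S T B)
      (attach (join t t′ c∈S (λ a b → meet′ a (p⊆p∪q B b)) nc″) P (q⊆p∪q S T d∈T) d∈B meet″ nc‴)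
    where
    nc″ : NoCross S T
    nc″ {u} {v} u∈S v∈T e with nc′ u∈S (p⊆p∪q B v∈T) e
    ... | inj₁ v∈S = inj₁ v∈S
    ... | inj₂ u∈TB = inj₂ (subst (_∈ T) (≡.sym (meet′ u∈S u∈TB)) (root∈ t′))
    meet″ : MeetAt d (S ∪ T) B
    meet″ {v} v∈ v∈B with x∈p∪q⁻ S T v∈
    ... | inj₂ v∈T = meet v∈T v∈B
    ... | inj₁ v∈S = meet (subst (_∈ T) (≡.sym (meet′ v∈S (q⊆p∪q T B v∈B))) (root∈ t′)) v∈B
    nc‴ : NoCross (S ∪ T) B
    nc‴ {u} {v} u∈ v∈B e with x∈p∪q⁻ S T u∈
    ... | inj₂ u∈T = Sum.map₁ (q⊆p∪q S T) (nc u∈T v∈B e)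
    ... | inj₁ u∈S with nc′ u∈S (q⊆p∪q T B v∈B) e
    ...   | inj₁ v∈S  = inj₁ (p⊆p∪q T v∈S)
    ...   | inj₂ u∈TB =
      Sum.map₁ (q⊆p∪q S T) (nc (subst (_∈ T) (≡.sym (meet′ u∈S u∈TB)) (root∈ t′)) v∈B e)

  -- If `s` lies in the last piece, that piece comes first and the rest, rerooted at the gluing
  -- vertex, is joined to it.
  reroot : Tree r q S → s ∈ S → Tree s q S
  reroot {r = r} {s = s} root s∈ = subst (λ a → Tree s 0 ⁅ a ⁆) (x∈⁅y⁆⇒x≡y r s∈) root
  reroot {s = s} (attach {q = q} {S = S} {B = B} {c = c} t P c∈S c∈B meet nc) s∈ with x∈p∪q⁻ S B s∈
  ... | inj₁ s∈S = attach (reroot t s∈S) P c∈S c∈B meet nc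
  ... | inj₂ s∈B = subst₂ (Tree s) (+-comm q 1) (∪-comm B S)
    (join (subst (Tree s 1) (⊆⇒∪≡ (⁅x⁆⊆ s∈B)) start) (reroot t c∈S) c∈B (λ a b → meet b a) (NoCross-sym nc))
    where
    start : Tree s 1 (⁅ s ⁆ ∪ B)
    start = attach root P (x∈⁅x⁆ s) s∈B (λ v∈ _ → x∈⁅y⁆⇒x≡y s v∈)
      (λ u∈ _ _ → inj₂ (⁅x⁆⊆ s∈B u∈))

  -- Any two vertices are linked through `c`, and sets with a single common vertex share no edge, so
  -- no edge receives both directions.
  joinOrientations : (O₁ : StrongOrientation S) (O₂ : StrongOrientation T) →
    c ∈ S → c ∈ T → MeetAt c S T → NoCross S T →
    Σ[ O ∈ StrongOrientation (S ∪ T) ]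
      ((∀ {u v} → StrongOrientation.R O₁ u v → StrongOrientation.R O u v) ×
       (∀ {u v} → StrongOrientation.R O₂ u v → StrongOrientation.R O u v))
  joinOrientations {S = S} {T = T} {c = c} O₁ O₂ c∈S c∈T meet nc = record
    { mixed = record
      { R      = R
      ; R?     = λ a b → O₁.R? a b ⊎-dec O₂.R? a b
      ; within = within
      ; covers = covers
      ; strong = λ a∈ b∈ → toC a∈ ◅◅ fromC b∈
      }
    ; asym = asym
    } , inj₁ , inj₂
    where
    module O₁ = StrongOrientation O₁
    module O₂ = StrongOrientation O₂
    R : Rel (Fin n) 0ℓ
    R a b = O₁.R a b ⊎ O₂.R a b
    within : ∀ {a b} → R a b → a ∈ S ∪ T × b ∈ S ∪ T × E G a b
    within (inj₁ ab) = let a∈ , b∈ , e = O₁.within ab in p⊆p∪q T a∈ , p⊆p∪q T b∈ , e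
    within (inj₂ ab) = let a∈ , b∈ , e = O₂.within ab in q⊆p∪q S T a∈ , q⊆p∪q S T b∈ , e
    covers₁ : ∀ {a b} → a ∈ S → b ∈ S → E G a b → R a b ⊎ R b a
    covers₁ a∈ b∈ e = Sum.map inj₁ inj₁ (O₁.covers a∈ b∈ e)
    covers₂ : ∀ {a b} → a ∈ T → b ∈ T → E G a b → R a b ⊎ R b a
    covers₂ a∈ b∈ e = Sum.map inj₂ inj₂ (O₂.covers a∈ b∈ e)
    covers : ∀ {a b} → a ∈ S ∪ T → b ∈ S ∪ T → E G a b → R a b ⊎ R b a
    covers a∈ b∈ e with x∈p∪q⁻ S T a∈ | x∈p∪q⁻ S T b∈
    ... | inj₁ a∈S | inj₁ b∈S = covers₁ a∈S b∈S e
    ... | inj₂ a∈T | inj₂ b∈T = covers₂ a∈T b∈T e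
    ... | inj₁ a∈S | inj₂ b∈T =
      [ (λ b∈S → covers₁ a∈S b∈S e) , (λ a∈T → covers₂ a∈T b∈T e) ]′ (nc a∈S b∈T e)
    ... | inj₂ a∈T | inj₁ b∈S =
      [ (λ a∈S → covers₁ a∈S b∈S e) , (λ b∈T → covers₂ a∈T b∈T e) ]′ (nc b∈S a∈T (E-sym e))
    toC : ∀ {a} → a ∈ S ∪ T → Star R a c
    toC a∈ with x∈p∪q⁻ S T a∈
    ... | inj₁ a∈S = Star.map inj₁ (O₁.strong a∈S c∈S)
    ... | inj₂ a∈T = Star.map inj₂ (O₂.strong a∈T c∈T)
    fromC : ∀ {a} → a ∈ S ∪ T → Star R c a
    fromC a∈ with x∈p∪q⁻ S T a∈
    ... | inj₁ a∈S = Star.map inj₁ (O₁.strong c∈S a∈S)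
    ... | inj₂ a∈T = Star.map inj₂ (O₂.strong c∈T a∈T)
    disjoint : ∀ {a b} → a ∈ S × b ∈ S × E G a b → ¬ (a ∈ T × b ∈ T × E G b a)
    disjoint (a∈S , b∈S , e) (a∈T , b∈T , _) =
      E⇒≢ e (trans (meet a∈S a∈T) (≡.sym (meet b∈S b∈T)))
    asym : ∀ {a b} → R a b → ¬ R b a
    asym (inj₁ ab) (inj₁ ba) = O₁.asym ab ba
    asym (inj₂ ab) (inj₂ ba) = O₂.asym ab ba
    asym (inj₁ ab) (inj₂ ba) = let b∈T , a∈T , e = O₂.within ba in disjoint (O₁.within ab) (a∈T , b∈T , e)
    asym (inj₂ ab) (inj₁ ba) = let a∈T , b∈T , e = O₂.within ab in disjoint (O₁.within ba) (b∈T , a∈T , e)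

  -- Induction step: two leaf pieces

  record Oriented (S : Subset n) (h : ℕ) (x y : Fin n) : Set₁ where
    field
      orientation : StrongOrientation S
    open StrongOrientation orientation using (R)
    field
      near : u ∈ S → v ∈ S → Near R h ∣ S ∣ u v
      x⇝y  : Near R (1 + h) ∣ S ∣ x y
      y⇝x  : Near R (1 + h) ∣ S ∣ y x

  module TwoLeaves {H A B : Subset n} {cA cB : Fin n} {h : ℕ} (I : Oriented H h cA cB)
    (PA : Piece A) (PB : Piece B) (cA∈H : cA ∈ H) (cB∈H : cB ∈ H) (cA∈A : cA ∈ A) (cB∈B : cB ∈ B)
    (meetB : MeetAt cB H B) (ncB : NoCross H B)
    (meetA : MeetAt cA (H ∪ B) A) (ncA : NoCross (H ∪ B) A) where

    private
      module I = Oriented I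
      g a b N : ℕ
      g = ∣ H ∣
      a = ∣ A ∣
      b = ∣ B ∣
      N = ∣ (H ∪ B) ∪ A ∣

      open ≤-Reasoning

      -- Each of the two gluings counts at most one vertex twice, hence the 2.
      total : g + a + b ≤ 2 + N
      total = begin
        g + a + b           ≡⟨ +-assoc g a b ⟩
        g + (a + b)         ≡⟨ cong (g +_) (+-comm a b) ⟩
        g + (b + a)         ≡⟨ +-assoc g b a ⟨
        g + b + a           ≤⟨ +-monoˡ-≤ a (∣∪∣-meetAt meetB) ⟩
        1 + (∣ H ∪ B ∣ + a) ≤⟨ s≤s (∣∪∣-meetAt meetA) ⟩
        2 + N               ∎

      -- By `3≤∣piece∣`, `B` has at least two vertices besides `cB`; as `cA` counts in both `g` and
      -- `a`, one of them remains as the gain.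
      withA : 1 + (g + a) ≤ N
      withA = +-cancelˡ-≤ 2 _ _ (begin
        3 + (g + a) ≡⟨ +-comm 3 (g + a) ⟩
        g + a + 3   ≤⟨ +-monoʳ-≤ (g + a) (3≤∣piece∣ PB) ⟩
        g + a + b   ≤⟨ total ⟩
        2 + N       ∎)

      withB : 1 + (g + b) ≤ N
      withB = +-cancelˡ-≤ 2 _ _ (begin
        3 + (g + b) ≡⟨ +-comm 3 (g + b) ⟩
        g + b + 3   ≤⟨ +-monoʳ-≤ (g + b) (3≤∣piece∣ PA) ⟩
        g + b + a   ≡⟨ +-assoc g b a ⟩
        g + (b + a) ≡⟨ cong (g +_) (+-comm b a) ⟩
        g + (a + b) ≡⟨ +-assoc g a b ⟨
        g + a + b   ≤⟨ total ⟩
        2 + N       ∎)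

      h<g : 1 + h ≤ g
      h<g = ≤-trans (m≤n+m (1 + h) (proj₁ I.x⇝y)) (proj₁ (proj₂ I.x⇝y))

      inside-bound : 2 + h + g ≤ N + h
      inside-bound = begin
        2 + h + g       ≡⟨ shuffle h g ⟩
        1 + (g + 1) + h ≤⟨ +-monoˡ-≤ h (s≤s (+-monoʳ-≤ g (<⇒≤ (<⇒≤ (3≤∣piece∣ PA))))) ⟩
        1 + (g + a) + h ≤⟨ +-monoˡ-≤ h withA ⟩
        N + h           ∎
        where
        shuffle : ∀ h g → 2 + h + g ≡ 1 + (g + 1) + h
        shuffle = solve-∀

      leaf-bound : ∀ {m} → 1 + (g + m) ≤ N → 2 + h + m ≤ N + 1
      leaf-bound {m} le = begin
        2 + h + m       ≤⟨ s≤s (+-monoˡ-≤ m h<g) ⟩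
        1 + (g + m)     ≤⟨ le ⟩
        N               ≤⟨ m≤m+n N 1 ⟩
        N + 1           ∎

      in-bound : ∀ {m} → 1 + (g + m) ≤ N → 2 + h + (g + m) ≤ N + (h + 1)
      in-bound {m} le = begin
        2 + h + (g + m)         ≡⟨ shuffle h (g + m) ⟩
        1 + (g + m) + (h + 1)   ≤⟨ +-monoˡ-≤ (h + 1) le ⟩
        N + (h + 1)             ∎
        where
        shuffle : ∀ h m → 2 + h + m ≡ 1 + m + (h + 1)
        shuffle = solve-∀

      out-bound : ∀ {m} → 1 + (g + m) ≤ N → 2 + h + (m + g) ≤ N + (1 + h)
      out-bound {m} le = subst₂ (λ i j → 2 + h + i ≤ N + j) (+-comm g m) (+-comm h 1) (in-bound le)

      -- `i` is the saving in the leaf piece where the walk starts: 1 in general, 2 from `sA` to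
      -- `cA` or from `sB` to `cB`. The walk through `H` saves 1 + h, the one in the last piece 1.
      across-bound : ∀ i → i + h + (a + (g + b)) ≤ N + (i + (1 + h + 1))
      across-bound i = begin
        i + h + (a + (g + b)) ≡⟨ shuffle i h a b g ⟩
        i + h + (g + a + b)   ≤⟨ +-monoʳ-≤ (i + h) total ⟩
        i + h + (2 + N)       ≡⟨ shuffle′ i h N ⟩
        N + (i + (1 + h + 1)) ∎
        where
        shuffle : ∀ i h a b g → i + h + (a + (g + b)) ≡ i + h + (g + a + b)
        shuffle = solve-∀
        shuffle′ : ∀ i h N → i + h + (2 + N) ≡ N + (i + (1 + h + 1))
        shuffle′ = solve-∀

      across-bound′ : ∀ i → i + h + (b + (g + a)) ≤ N + (i + (1 + h + 1))
      across-bound′ i = subst (λ m → i + h + m ≤ N + (i + (1 + h + 1))) (shuffle a b g) (across-bound i)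
        where
        shuffle : ∀ a b g → a + (g + b) ≡ b + (g + a)
        shuffle = solve-∀

    module _ {sA sB : Fin n} (sA∈A : sA ∈ A) (sB∈B : sB ∈ B) where

      private
        towardsA = orientTowards PA sA∈A cA∈A
        towardsB = orientTowards PB sB∈B cB∈B
        OA = proj₁ towardsA
        OB = proj₁ towardsB
        joinB = joinOrientations I.orientation OB cB∈H cB∈B meetB ncB
        joinA = joinOrientations (proj₁ joinB) OA (p⊆p∪q B cA∈H) cA∈A meetA ncA
        O : StrongOrientation ((H ∪ B) ∪ A)
        O = proj₁ joinA
        open StrongOrientation O using (R)

        inH : ∀ {i M} → Near (StrongOrientation.R I.orientation) i M u v → Near R i M u v
        inH = Near-map (proj₁ (proj₂ joinA) ∘ proj₁ (proj₂ joinB))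
        inB : ∀ {i M} → Near (StrongOrientation.R OB) i M u v → Near R i M u v
        inB = Near-map (proj₁ (proj₂ joinA) ∘ proj₂ (proj₂ joinB))
        inA : ∀ {i M} → Near (StrongOrientation.R OA) i M u v → Near R i M u v
        inA = Near-map (proj₂ (proj₂ joinA))

        nearH : u ∈ H → v ∈ H → Near R h g u v
        nearH u∈ v∈ = inH (I.near u∈ v∈)
        nearA : u ∈ A → v ∈ A → Near R 1 a u v
        nearA u∈ v∈ = inA (near-within OA u∈ v∈)
        nearB : u ∈ B → v ∈ B → Near R 1 b u v
        nearB u∈ v∈ = inB (near-within OB u∈ v∈)

        Loc : Fin n → Set
        Loc u = u ∈ H ⊎ u ∈ B ⊎ u ∈ A

        loc : u ∈ (H ∪ B) ∪ A → Loc u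
        loc u∈ with x∈p∪q⁻ (H ∪ B) A u∈
        ... | inj₂ u∈A  = inj₂ (inj₂ u∈A)
        ... | inj₁ u∈HB = Sum.map₂ inj₁ (x∈p∪q⁻ H B u∈HB)

      Crossing : Fin n → Fin n → Set
      Crossing u v = (u ∈ A × v ∈ B) ⊎ (u ∈ B × v ∈ A)

      private
        crossing : Crossing u v → Near R (1 + h) N u v
        crossing (inj₁ (u∈A , v∈B)) = Near-weaken (across-bound 1)
          (Near-trans (nearA u∈A cA∈A) (Near-trans (inH I.x⇝y) (nearB cB∈B v∈B)))
        crossing (inj₂ (u∈B , v∈A)) = Near-weaken (across-bound′ 1)
          (Near-trans (nearB u∈B cB∈B) (Near-trans (inH I.y⇝x) (nearA cA∈A v∈A)))

        sA⇝sB : Near R (2 + h) N sA sB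
        sA⇝sB = Near-weaken (across-bound 2)
          (Near-trans (inA (proj₂ towardsA)) (Near-trans (inH I.x⇝y) (nearB cB∈B sB∈B)))

        sB⇝sA : Near R (2 + h) N sB sA
        sB⇝sA = Near-weaken (across-bound′ 2)
          (Near-trans (inB (proj₂ towardsB)) (Near-trans (inH I.y⇝x) (nearA cA∈A sA∈A)))

        -- Pairs that do not cross attain the sharper bound whatever `sA` and `sB` are.
        near-or-crossing : Loc u → Loc v → Near R (2 + h) N u v ⊎ Crossing u v
        near-or-crossing (inj₁ u∈H)        (inj₁ v∈H)        =
          inj₁ (Near-weaken inside-bound (nearH u∈H v∈H))
        near-or-crossing (inj₁ u∈H)        (inj₂ (inj₁ v∈B)) =
          inj₁ (Near-weaken (in-bound withB) (Near-trans (nearH u∈H cB∈H) (nearB cB∈B v∈B)))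
        near-or-crossing (inj₁ u∈H)        (inj₂ (inj₂ v∈A)) =
          inj₁ (Near-weaken (in-bound withA) (Near-trans (nearH u∈H cA∈H) (nearA cA∈A v∈A)))
        near-or-crossing (inj₂ (inj₁ u∈B)) (inj₁ v∈H)        =
          inj₁ (Near-weaken (out-bound withB) (Near-trans (nearB u∈B cB∈B) (nearH cB∈H v∈H)))
        near-or-crossing (inj₂ (inj₂ u∈A)) (inj₁ v∈H)        =
          inj₁ (Near-weaken (out-bound withA) (Near-trans (nearA u∈A cA∈A) (nearH cA∈H v∈H)))
        near-or-crossing (inj₂ (inj₁ u∈B)) (inj₂ (inj₁ v∈B)) =
          inj₁ (Near-weaken (leaf-bound withB) (nearB u∈B v∈B))
        near-or-crossing (inj₂ (inj₂ u∈A)) (inj₂ (inj₂ v∈A)) =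
          inj₁ (Near-weaken (leaf-bound withA) (nearA u∈A v∈A))
        near-or-crossing (inj₂ (inj₁ u∈B)) (inj₂ (inj₂ v∈A)) = inj₂ (inj₂ (u∈B , v∈A))
        near-or-crossing (inj₂ (inj₂ u∈A)) (inj₂ (inj₁ v∈B)) = inj₂ (inj₁ (u∈A , v∈B))

        oriented : Near R (2 + h) N x y → Near R (2 + h) N y x → Oriented ((H ∪ B) ∪ A) (1 + h) x y
        oriented xy yx = record
          { orientation = O
          ; near = λ u∈ v∈ →
              [ Near-weaken (≤-trans (n≤1+n _) (≤-reflexive (+-comm (2 + h) N))) , crossing ]′
                (near-or-crossing (loc u∈) (loc v∈))
          ; x⇝y = xy
          ; y⇝x = yx
          }

      oriented-s : Oriented ((H ∪ B) ∪ A) (1 + h) sA sB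
      oriented-s = oriented sA⇝sB sB⇝sA

      oriented-or-crossing : x ∈ (H ∪ B) ∪ A → y ∈ (H ∪ B) ∪ A →
        Oriented ((H ∪ B) ∪ A) (1 + h) x y ⊎ Crossing x y
      oriented-or-crossing x∈ y∈
        with near-or-crossing (loc x∈) (loc y∈) | near-or-crossing (loc y∈) (loc x∈)
      ... | inj₁ xy | inj₁ yx = inj₁ (oriented xy yx)
      ... | inj₂ c  | _       = inj₂ c
      ... | inj₁ _  | inj₂ c  = inj₂ (Sum.swap (Sum.map swap swap c))

    extend : x ∈ (H ∪ B) ∪ A → y ∈ (H ∪ B) ∪ A → Oriented ((H ∪ B) ∪ A) (1 + h) x y
    -- The choice of `sA` and `sB` matters for crossing pairs only, so the gluing vertices serve as
    -- defaults; a crossing pair is itself taken as `sA` and `sB`.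
    extend x∈ y∈ with oriented-or-crossing cA∈A cB∈B x∈ y∈
    ... | inj₁ o                  = o
    ... | inj₂ (inj₁ (x∈A , y∈B)) = oriented-s x∈A y∈B
    ... | inj₂ (inj₂ (x∈B , y∈A)) = record
      { orientation = o.orientation ; near = o.near ; x⇝y = o.y⇝x ; y⇝x = o.x⇝y }
      where module o = Oriented (oriented-s y∈A x∈B)

  -- Pieces are stripped in pairs, each pair saving one unit. With zero or one piece left, `⌊ q /2⌋`
  -- is 0 and the extra unit for `x` and `y` is the one any strong orientation gives.
  orient : ∀ q → Tree r q S → x ∈ S → y ∈ S → Oriented S ⌊ q /2⌋ x y
  orient {r = r} zero root x∈ y∈ = record
    { orientation = record
      { mixed = record
        { R      = λ _ _ → ⊥
        ; R?     = λ _ _ → no λ ()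
        ; within = λ ()
        ; covers = λ u∈ v∈ e → contradiction (same u∈ v∈) (E⇒≢ e)
        ; strong = λ u∈ v∈ → subst (Star _ _) (same u∈ v∈) ε
        }
      ; asym = λ ()
      }
    ; near = λ u∈ v∈ → at u∈ v∈ z≤n
    ; x⇝y  = at x∈ y∈ 1≤
    ; y⇝x  = at y∈ x∈ 1≤
    }
    where
    same : u ∈ ⁅ r ⁆ → v ∈ ⁅ r ⁆ → u ≡ v
    same u∈ v∈ = trans (x∈⁅y⁆⇒x≡y r u∈) (≡.sym (x∈⁅y⁆⇒x≡y r v∈))
    1≤ : 1 ≤ ∣ ⁅ r ⁆ ∣
    1≤ = ≤-reflexive (≡.sym (∣⁅x⁆∣≡1 r))
    at : ∀ {R h} → u ∈ ⁅ r ⁆ → v ∈ ⁅ r ⁆ → h ≤ ∣ ⁅ r ⁆ ∣ → Near R h ∣ ⁅ r ⁆ ∣ u v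
    at u∈ v∈ h≤ = subst (Near _ _ _ _) (same u∈ v∈) (Near-refl h≤)
  orient {r = r} {x = x} {y = y} (suc zero) (attach {B = B} root P c∈r c∈B _ _) =
    subst (λ S → x ∈ S → y ∈ S → Oriented S 0 x y)
      (≡.sym (⊆⇒∪≡ (⁅x⁆⊆ (subst (_∈ B) (x∈⁅y⁆⇒x≡y r c∈r) c∈B))))
      λ x∈ y∈ → record
        { orientation = O
        ; near = λ u∈ v∈ → Near-weaken (m≤m+n ∣ B ∣ 1) (near-within O u∈ v∈)
        ; x⇝y  = near-within O x∈ y∈
        ; y⇝x  = near-within O y∈ x∈
        }
    where O = robbins (Piece.bridgeless P)
  -- Rooting the rest at the gluing vertex of `PA` ensures that the second leaf `PB` can be stripped
  -- without losing that vertex.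
  orient (suc (suc q)) (attach t PA cA∈ cA∈A meetA ncA) x∈ y∈ with reroot t cA∈
  ... | attach t′ PB cB∈ cB∈B meetB ncB =
    TwoLeaves.extend (orient q t′ (root∈ t′) cB∈) PA PB (root∈ t′) cB∈ cA∈A cB∈B meetB ncB meetA ncA x∈ y∈

  -- Decomposition at cut vertices

  module _ {S S₁ S₂ : Subset n} {w : Fin n} (S₁⊆S : S₁ ⊆ S) (w∈S₁ : w ∈ S₁)
    (cover : ∀ {z} → z ∈ S → z ∈ S₁ ⊎ z ∈ S₂) (meet : MeetAt w S₁ S₂) (nc : NoCross S₁ S₂) where

    private
      -- Everything outside `S₁` is folded onto `w`. Edges leaving `S₁` start at `w`, so walks fold
      -- to walks.
      π : Fin n → Fin n
      π a with a ∈? S₁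
      ... | yes _ = a
      ... | no _  = w

      π-fix : u ∈ S₁ → π u ≡ u
      π-fix {u} u∈ with u ∈? S₁
      ... | yes _ = refl
      ... | no u∉ = contradiction u∈ u∉

      outside∈S₂ : u ∈ S → u ∉ S₁ → u ∈ S₂
      outside∈S₂ u∈S u∉ = [ (λ u∈ → contradiction u∈ u∉) , id ]′ (cover u∈S)

      leave : u ∈ S₁ → v ∈ S → v ∉ S₁ → E G u v → u ≡ w
      leave u∈ v∈S v∉ e with nc u∈ (outside∈S₂ v∈S v∉) e
      ... | inj₁ v∈ = contradiction v∈ v∉
      ... | inj₂ u∈S₂ = meet u∈ u∈S₂

      π-step : ∀ {R} → (∀ {a b} → R a b → E G a b) → On S R u v → Star (On S₁ R) (π u) (π v)
      π-step {u} {v} R⊆E (u∈S , v∈S , r) with u ∈? S₁ | v ∈? S₁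
      ... | yes u∈ | yes v∈ = (u∈ , v∈ , r) ◅ ε
      ... | yes u∈ | no v∉  = subst (Star _ u) (leave u∈ v∈S v∉ (R⊆E r)) ε
      ... | no u∉  | yes v∈ = subst (Star _ w) (≡.sym (leave v∈ u∈S u∉ (E-sym (R⊆E r)))) ε
      ... | no _   | no _   = ε

    project : ∀ {R} → (∀ {a b} → R a b → E G a b) → u ∈ S₁ → v ∈ S₁ →
              Star (On S R) u v → Star (On S₁ R) u v
    project R⊆E u∈ v∈ p =
      subst₂ (Star _) (π-fix u∈) (π-fix v∈) (Star.kleisliStar π (π-step R⊆E) p)

    -- The projection works for any relation contained in the edges, hence also after removal of an
    -- edge.
    bridgeless-part : BridgelessOn S → BridgelessOn S₁
    bridgeless-part bl = record
      { connected = λ u∈ v∈ → project id u∈ v∈ (connected (S₁⊆S u∈) (S₁⊆S v∈))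
      ; detour    = λ u∈ v∈ e → project proj₁ u∈ v∈ (detour (S₁⊆S u∈) (S₁⊆S v∈) e)
      }
      where open BridgelessOn bl

  Separates : Subset n → Fin n → Fin n → Fin n → Set
  Separates S w u v =
    w ∈ S × (u ∈ S × u ≢ w) × (v ∈ S × v ≢ w) × ¬ Star (Avoiding S w (E G)) u v

  avoiding? : ∀ S w → Decidable (Star (Avoiding S w (E G)))
  avoiding? S w = reach? λ a b →
    (a ∈? S ×-dec ¬? (a ≟ w)) ×-dec (b ∈? S ×-dec ¬? (b ≟ w)) ×-dec E? a b

  separates? : ∀ S w u v → Dec (Separates S w u v)
  separates? S w u v = w ∈? S ×-dec (u ∈? S ×-dec ¬? (u ≟ w)) ×-dec
    (v ∈? S ×-dec ¬? (v ≟ w)) ×-dec ¬? (avoiding? S w u v)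

  unseparated⇒tree : BridgelessOn S → r ∈ S → ¬ (∃[ w ] ∃[ u ] ∃[ v ] Separates S w u v) →
                     ∃[ q ] Tree r q S
  unseparated⇒tree {S} {r} bl r∈S ¬sep with any? (λ y → y ∈? S ×-dec ¬? (r ≟ y))
  ... | no ¬y = 0 , subst (Tree r 0) (⊆-antisym (⁅x⁆⊆ r∈S) S⊆⁅r⁆) root
    where
    S⊆⁅r⁆ : S ⊆ ⁅ r ⁆
    S⊆⁅r⁆ {y} y∈S =
      subst (_∈ ⁅ r ⁆) (decidable-stable (r ≟ y) (λ r≢y → ¬y (y , y∈S , r≢y))) (x∈⁅x⁆ r)
  ... | yes (y , y∈S , r≢y) = 1 , subst (Tree r 1) (⊆⇒∪≡ (⁅x⁆⊆ r∈S))
    (attach root piece (x∈⁅x⁆ r) r∈S (λ v∈ _ → x∈⁅y⁆⇒x≡y r v∈) (λ u∈ _ _ → inj₂ (⁅x⁆⊆ r∈S u∈)))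
    where
    piece : Piece S
    piece = record
      { noCut = (r , r∈S)
              , (λ u v u∈ v∈ → Star⇒Walk (BridgelessOn.connected bl u∈ v∈))
              , (λ w w∈ u v u∈ v∈ → Star⇒Walk (decidable-stable (avoiding? S w u v)
                  (λ ¬p → ¬sep (w , u , v , w∈ , u∈ , v∈ , ¬p))))
      ; bridgeless = bl
      ; distinct   = r , y , r∈S , y∈S , r≢y
      }

  record Split (S : Subset n) (w : Fin n) : Set where
    field
      S₁ S₂ : Subset n
      w∈S₁  : w ∈ S₁
      w∈S₂  : w ∈ S₂
      S₁⊂S  : S₁ ⊂ S
      S₂⊂S  : S₂ ⊂ S
      cover : ∀ {z} → z ∈ S → z ∈ S₁ ⊎ z ∈ S₂
      meet  : MeetAt w S₁ S₂
      nc    : NoCross S₁ S₂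

    S₁∪S₂≡S : S₁ ∪ S₂ ≡ S
    S₁∪S₂≡S = ⊆-antisym ([ proj₁ S₁⊂S , proj₁ S₂⊂S ]′ ∘ x∈p∪q⁻ S₁ S₂) (x∈p∪q⁺ ∘ cover)

  -- `S₁` is `w` with all that `u` reaches without it, `S₂` is `w` with the rest; `v` and `u` show
  -- that both are proper.
  split : Separates S w u v → Split S w
  split {S} {w} {u} {v} (w∈S , (u∈S , u≢w) , (v∈S , v≢w) , ¬u⇝v) = record
    { S₁ = S₁ ; S₂ = S₂ ; w∈S₁ = w∈S₁ ; w∈S₂ = w∈S₂
    ; S₁⊂S = S₁⊆S , v , v∈S , v∉S₁ ; S₂⊂S = S₂⊆S , u , u∈S , u∉S₂
    ; cover = cover ; meet = meet ; nc = nc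
    }
    where
    P₁ P₂ : Pred (Fin n) 0ℓ
    P₁ z = z ≡ w ⊎ ((z ∈ S × z ≢ w) × Star (Avoiding S w (E G)) u z)
    P₂ z = z ≡ w ⊎ ((z ∈ S × z ≢ w) × ¬ Star (Avoiding S w (E G)) u z)
    P₁? : Decidable₁ P₁
    P₁? z = (z ≟ w) ⊎-dec ((z ∈? S ×-dec ¬? (z ≟ w)) ×-dec avoiding? S w u z)
    P₂? : Decidable₁ P₂
    P₂? z = (z ≟ w) ⊎-dec ((z ∈? S ×-dec ¬? (z ≟ w)) ×-dec ¬? (avoiding? S w u z))
    S₁ S₂ : Subset n
    S₁ = filter P₁?
    S₂ = filter P₂?
    w∈S₁ : w ∈ S₁
    w∈S₁ = ∈-filter⁺ P₁? (inj₁ refl)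
    w∈S₂ : w ∈ S₂
    w∈S₂ = ∈-filter⁺ P₂? (inj₁ refl)
    S₁⊆S : S₁ ⊆ S
    S₁⊆S z∈ = [ (λ { refl → w∈S }) , proj₁ ∘ proj₁ ]′ (∈-filter⁻ P₁? z∈)
    S₂⊆S : S₂ ⊆ S
    S₂⊆S z∈ = [ (λ { refl → w∈S }) , proj₁ ∘ proj₁ ]′ (∈-filter⁻ P₂? z∈)
    v∉S₁ : v ∉ S₁
    v∉S₁ v∈ = [ v≢w , ¬u⇝v ∘ proj₂ ]′ (∈-filter⁻ P₁? v∈)
    u∉S₂ : u ∉ S₂
    u∉S₂ u∈ = [ u≢w , (λ p → proj₂ p ε) ]′ (∈-filter⁻ P₂? u∈)
    cover : ∀ {z} → z ∈ S → z ∈ S₁ ⊎ z ∈ S₂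
    cover {z} z∈S with z ≟ w | avoiding? S w u z
    ... | yes z≡w | _     = inj₁ (∈-filter⁺ P₁? (inj₁ z≡w))
    ... | no z≢w  | yes p = inj₁ (∈-filter⁺ P₁? (inj₂ ((z∈S , z≢w) , p)))
    ... | no z≢w  | no ¬p = inj₂ (∈-filter⁺ P₂? (inj₂ ((z∈S , z≢w) , ¬p)))
    meet : MeetAt w S₁ S₂
    meet z∈₁ z∈₂ with ∈-filter⁻ P₁? z∈₁ | ∈-filter⁻ P₂? z∈₂
    ... | inj₁ z≡w     | _              = z≡w
    ... | inj₂ _       | inj₁ z≡w       = z≡w
    ... | inj₂ (_ , p) | inj₂ (_ , ¬p) = contradiction p ¬p
    nc : NoCross S₁ S₂
    nc a∈ b∈ e with ∈-filter⁻ P₁? a∈ | ∈-filter⁻ P₂? b∈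
    ... | inj₁ refl     | _              = inj₂ w∈S₂
    ... | inj₂ _        | inj₁ refl      = inj₁ w∈S₁
    ... | inj₂ (a∈ , p) | inj₂ (b∈ , ¬p) = contradiction (p ◅◅ (a∈ , b∈ , e) ◅ ε) ¬p

  -- Both parts of a split are proper, so the size decreases; their trees are rooted at the cut
  -- vertex `w` and joined there.
  decompose : ∀ m → ∣ S ∣ ≤ m → BridgelessOn S → r ∈ S → ∃[ q ] Tree r q S
  decompose {S} {r} m S≤m bl r∈S with any? (λ w → any? λ u → any? λ v → separates? S w u v)
  ... | no ¬sep = unseparated⇒tree bl r∈S ¬sep
  decompose zero S≤m bl r∈S | yes _ =
    contradiction (≤-<-trans z≤n (x∈p⇒∣p-x∣<∣p∣ r∈S)) (≤⇒≯ S≤m)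
  decompose {S} {r} (suc m) S≤m bl r∈S | yes (w , _ , _ , sep) =
    let _ , t₁ = decompose m (≤-pred (≤-trans (p⊂q⇒∣p∣<∣q∣ S₁⊂S) S≤m))
                   (bridgeless-part (proj₁ S₁⊂S) w∈S₁ cover meet nc bl) w∈S₁
        _ , t₂ = decompose m (≤-pred (≤-trans (p⊂q⇒∣p∣<∣q∣ S₂⊂S) S≤m))
                   (bridgeless-part (proj₁ S₂⊂S) w∈S₂ (Sum.swap ∘ cover) (λ a b → meet b a)
                     (NoCross-sym nc) bl) w∈S₂
    in  _ , reroot (subst (Tree w _) S₁∪S₂≡S (join t₁ t₂ w∈S₁ meet nc)) r∈S
    where open Split (split sep)

  -- Every block is a piece

  pieces : Tree r q S → Fin q → Subset n
  pieces (attach {B = B} _ _ _ _ _ _) zero    = B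
  pieces (attach t _ _ _ _ _)         (suc i) = pieces t i

  pieces-noCut : (t : Tree r q S) (i : Fin q) → ConnNoCut G (pieces t i)
  pieces-noCut (attach _ P _ _ _ _) zero    = Piece.noCut P
  pieces-noCut (attach t _ _ _ _ _) (suc i) = pieces-noCut t i

  -- If `c` lies outside `T`, connectivity alone suffices.
  connected-avoiding : ConnNoCut G T → ∀ c → u ∈ T → v ∈ T → u ≢ c → v ≢ c →
                       Star (Avoiding T c (E G)) u v
  connected-avoiding {T} {u} {v} (_ , conn , noCut) c u∈T v∈T u≢c v≢c with c ∈? T
  ... | yes c∈T = Walk⇒Star (proj₂ (noCut c c∈T u v (u∈T , u≢c) (v∈T , v≢c)))
  ... | no c∉T  = Star.map (λ (a∈ , b∈ , e) → (a∈ , ≢c a∈) , (b∈ , ≢c b∈) , e)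
                    (Walk⇒Star (proj₂ (conn u v u∈T v∈T)))
    where
    ≢c : ∀ {a} → a ∈ T → a ≢ c
    ≢c a∈ refl = c∉T a∈

  -- Otherwise a vertex of `T` off `S` is joined to one off `B` by a walk avoiding `c`, but no such
  -- walk leaves `B`.
  noCut⊆side : ConnNoCut G T → T ⊆ S ∪ B → c ∈ S → c ∈ B → MeetAt c S B → NoCross S B →
               T ⊆ S ⊎ T ⊆ B
  noCut⊆side {T} {S} {B} {c} ncT T⊆ c∈S c∈B meet nc with T ⊆? S | T ⊆? B
  ... | yes T⊆S | _       = inj₁ T⊆S
  ... | no _    | yes T⊆B = inj₂ T⊆B
  ... | no T⊈S  | no T⊈B with ⊆-witness T⊈S | ⊆-witness T⊈B
  ...   | u , u∈T , u∉S | v , v∈T , v∉B = contradiction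
    (stay (connected-avoiding ncT c u∈T v∈T (λ { refl → u∉S c∈S }) (λ { refl → v∉B c∈B }))
      ([ (λ u∈S → contradiction u∈S u∉S) , id ]′ (x∈p∪q⁻ S B (T⊆ u∈T))))
    v∉B
    where
    stay : ∀ {a b} → Star (Avoiding T c (E G)) a b → a ∈ B → b ∈ B
    stay ε a∈B = a∈B
    stay (((_ , a≢c) , (b∈T , _) , e) ◅ p) a∈B with x∈p∪q⁻ S B (T⊆ b∈T)
    ... | inj₂ b∈B = stay p b∈B
    ... | inj₁ b∈S with nc b∈S a∈B (E-sym e)
    ...   | inj₁ a∈S = contradiction (meet a∈S a∈B) a≢c
    ...   | inj₂ b∈B = stay p b∈B

  noCut⊆piece : (t : Tree r (suc q) S) → ConnNoCut G T → T ⊆ S → ∃[ i ] T ⊆ pieces t i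
  noCut⊆piece (attach t P c∈S c∈B meet nc) ncT T⊆ with noCut⊆side ncT T⊆ c∈S c∈B meet nc
  ... | inj₂ T⊆B = zero , T⊆B
  -- Below the first piece there is only the root, which is the gluing vertex and lies in that
  -- piece.
  noCut⊆piece {T = T} (attach {B = B} (root {r}) P c∈S c∈B meet nc) ncT T⊆ | inj₁ T⊆S =
    zero , λ v∈T → ⁅x⁆⊆ (subst (_∈ B) (x∈⁅y⁆⇒x≡y r c∈S) c∈B) (T⊆S v∈T)
  noCut⊆piece (attach t@(attach _ _ _ _ _ _) P c∈S c∈B meet nc) ncT T⊆ | inj₁ T⊆S =
    let i , T⊆i = noCut⊆piece t ncT T⊆S in suc i , T⊆i

  -- By maximality a block fills the piece containing it, so distinct blocks give distinct pieces.
  -- At least one piece is required: a single vertex is a block but its tree has no pieces.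
  #blocks≤#pieces : ∀ {p b} → BlockEnumeration G p b → Tree r (suc q) ⊤ → p ≤ suc q
  #blocks≤#pieces {q = q} {p} {b} (inj , isBlock , _) t =
    injective⇒≤ {f = proj₁ ∘ index} λ {i} {j} eq → inj i j
      (trans (≡.sym (proj₂ (index i))) (trans (cong (pieces t) eq) (proj₂ (index j))))
    where
    index : ∀ j → ∃[ i ] pieces t i ≡ b j
    index j with isBlock j
    ... | ncB , maximal with noCut⊆piece t ncB (λ _ → ∈⊤)
    ...   | i , B⊆i = i , ⊆-antisym (maximal (pieces t i) B⊆i (pieces-noCut t i)) B⊆i

  -- From the whole graph to the theorem

  bridgelessOn-⊤ : Bridgeless G → BridgelessOn ⊤
  bridgelessOn-⊤ ((_ , conn) , noBridge) = record
    { connected = λ {u} {v} _ _ → toOn (proj₂ (conn u v _ _))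
    -- Having no bridge only refutes the lack of a detour; decidable reachability then supplies one.
    ; detour    = λ {u} {v} _ _ e → decidable-stable
        (map′ (Star.map λ r → ∈⊤ , ∈⊤ , r) (Star.map (proj₂ ∘ proj₂)) (reach? (EdgeMinus? u v) u v))
        (λ ¬p → noBridge u v (e , λ conn′ → ¬p (toOn (proj₂ (conn′ u v _ _)))))
    }
    where
    toOn : ∀ {R u v k} → Walk (Restrict (λ _ → Unit.⊤) R) u v k → Star (On ⊤ R) u v
    toOn = Star.map (λ (_ , _ , r) → ∈⊤ , ∈⊤ , r) ∘ Walk⇒Star
    EdgeMinus? : ∀ u v → Decidable (EdgeMinus G u v)
    EdgeMinus? u v a b = E? a b ×-dec
      ¬? (((a ≟ u) ×-dec (b ≟ v)) ⊎-dec ((a ≟ v) ×-dec (b ≟ u)))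

  orientedDiam : ∀ {d} (O : StrongOrientation ⊤) →
    (∀ u v → ∃[ k ] (k ≤ d × Walk (StrongOrientation.R O) u v k)) → OrientedDiamAtMost G d
  orientedDiam O near = D , (D⊆E , E⊆D , D-asym)
    , (λ u v → let k , _ , p = near u v in k , Walk-map R⇒D p)
    , (λ u v → let k , k≤ , p = near u v in k , k≤ , Walk-map R⇒D p)
    where
    open StrongOrientation O
    D = λ u v → does (R? u v)
    R⇒D : R u v → D u v ≡ true
    R⇒D {u} {v} = dec-true (R? u v)
    D⇒R : D u v ≡ true → R u v
    D⇒R {u} {v} eq with R? u v
    ... | yes r = r
    D⇒R () | no _
    D⊆E : ∀ u v → D u v ≡ true → E G u v
    D⊆E u v d = proj₂ (proj₂ (within (D⇒R d)))
    E⊆D : ∀ u v → E G u v → D u v ≡ true ⊎ D v u ≡ true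
    E⊆D u v e = Sum.map R⇒D R⇒D (covers ∈⊤ ∈⊤ e)
    D-asym : ∀ u v → D u v ≡ true → D v u ≡ false
    D-asym u v d = dec-false (R? v u) (asym (D⇒R d))

n/2≡⌊n/2⌋ : ∀ n → n / 2 ≡ ⌊ n /2⌋
n/2≡⌊n/2⌋ zero          = refl
n/2≡⌊n/2⌋ (suc zero)    = refl
n/2≡⌊n/2⌋ (suc (suc n)) =
  trans (m/n≡1+[m∸n]/n {suc (suc n)} {2} (s≤s (s≤s z≤n))) (cong suc (n/2≡⌊n/2⌋ n))

theorem1 : (n : ℕ) (G : Graph n) (p : ℕ) (b : Fin p → Subset n) →
    Bridgeless G → BlockEnumeration G p b →
    OrientedDiamAtMost G (n ∸ p / 2)
theorem1 n G p b bridgeless@(((r , _) , _) , _) blocks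
  with decompose G ∣ ⊤ {n} ∣ ≤-refl (bridgelessOn-⊤ G bridgeless) (∈⊤ {x = r})
-- Without pieces the graph is a single vertex and all distances are 0, so no comparison with the
-- number of blocks is made.
... | zero , t = orientedDiam G (Oriented.orientation o) λ u v →
    0 , z≤n , subst (λ w → Walk _ u w 0) (trans (only t ∈⊤) (≡.sym (only t ∈⊤))) here
  where
  o = orient G 0 t (∈⊤ {x = r}) (∈⊤ {x = r})
  only : ∀ {S u} → Tree G r 0 S → u ∈ S → u ≡ r
  only root u∈ = x∈⁅y⁆⇒x≡y r u∈
... | suc q , t = orientedDiam G (Oriented.orientation o) λ u v →
    let k , k≤ , w = Oriented.near o (∈⊤ {x = u}) (∈⊤ {x = v}) in k , bound k k≤ , w
  where
  o = orient G (suc q) t (∈⊤ {x = r}) (∈⊤ {x = r})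
  bound : ∀ k → k + ⌊ suc q /2⌋ ≤ ∣ ⊤ {n} ∣ → k ≤ n ∸ p / 2
  bound k k≤ = begin
    k                 ≤⟨ m+n≤o⇒m≤o∸n k (subst (k + ⌊ suc q /2⌋ ≤_) (∣⊤∣≡n n) k≤) ⟩
    n ∸ ⌊ suc q /2⌋   ≤⟨ ∸-monoʳ-≤ n (⌊n/2⌋-mono (#blocks≤#pieces G blocks t)) ⟩
    n ∸ ⌊ p /2⌋       ≡⟨ cong (n ∸_) (n/2≡⌊n/2⌋ p) ⟨
    n ∸ p / 2         ∎
    where open ≤-Reasoning
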